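{- Let $p<q$ be primes. The polynomial $I(\varGamma(\mathbb{Z}_{pq}),x)$ is log-concave and unimodal.
   Context: For a positive integer $n$, the zero divisor graph $\varGamma(\mathbb{Z}_n)$ is the simple undirected graph whose vertices are the non-zero zero divisors of the ring $\mathbb{Z}_n$ of integers modulo $n$ (non-zero $a$ such that $ab=0$ for some non-zero $b$), two distinct vertices $a,b$ being adjacent if and only if $ab=0$ in $\mathbb{Z}_n$. An independent set of a finite graph $G$ is a set of vertices no two of which are adjacent (the empty set included); $\alpha(G)$ is the maximum size of an independent set, and $s_k(G)$ is the number of independent sets of size $k$. The independence polynomial of $G$ is $I(G,x)=\sum_{k=0}^{\alpha(G)} s_k(G)x^k$. A polynomial $\sum_{i=0}^{n}\ell_i x^i$ (of degree $n$) is log-concave if $\ell_j^2\ge \ell_{j-1}\ell_{j+1}$ for all $1\le j\le n-1$; it is unimodal if there is an index $m$, $0\le m\le n$, with $\ell_0\le \ell_1\le\dots\le \ell_m\ge \ell_{m+1}\ge\dots\ge \ell_n$. -}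

module Defs where

open import Data.Bool.Base using (true; false)
open import Data.Fin.Base using (Fin; toℕ)
import Data.Fin.Properties as Fin
open import Data.Fin.Subset using (Subset; ∣_∣; Lift; inside; outside; ⊥)
open import Data.Fin.Subset.Properties using (Lift?; ∉⊥; ∣⊥∣≡0)
open import Data.List.Base using (List; []; _∷_; _++_; map; filter; length)
open import Data.List.Extrema.Nat using (argmax; argmax-all; f[xs]≤f[argmax])
open import Data.List.Membership.Propositional using (_∈_)
open import Data.List.Membership.Propositional.Properties
  using (∈-++⁺ˡ; ∈-++⁺ʳ; ∈-map⁺; ∈-filter⁺; ∈-length)
open import Data.List.Properties using (filter-none)
open import Data.List.Relation.Unary.All as All using (All)
open import Data.List.Relation.Unary.All.Properties using (all-filter)
open import Data.List.Relation.Unary.Any using (here)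
open import Data.Nat.Base
  using (ℕ; zero; suc; _+_; _*_; _∸_; _^_; _≤_; _<_; NonZero)
import Data.Nat.Properties as ℕ
open import Data.Nat.DivMod using (_mod_)
open import Data.Product.Base using (_×_; _,_; ∃-syntax)
open import Data.Vec.Base using ([]; _∷_)
open import Function.Base using (_∘_)
open import Level using (0ℓ)
open import Relation.Binary.Core using (Rel)
import Relation.Binary.Definitions as B
open import Relation.Binary.PropositionalEquality
  using (_≡_; _≢_; refl; sym; cong; subst)
open import Relation.Nullary using (¬_; contradiction)
open import Relation.Nullary.Decidable using (_×-dec_; ¬?)
open import Relation.Unary using (Pred; Decidable)

-- A nonzero polynomial ∑ ℓᵢ xⁱ, as its coefficient sequence together
-- with its exact degree.
record Polynomial : Set where
  field
    degree  : ℕ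
    coeff   : ℕ → ℕ
    leading : coeff degree ≢ 0
    above   : ∀ i → degree < i → coeff i ≡ 0

LogConcave : Polynomial → Set
LogConcave f = ∀ j → 1 ≤ j → j ≤ degree ∸ 1 →
               coeff (j ∸ 1) * coeff (j + 1) ≤ coeff j ^ 2
  where open Polynomial f

Unimodal : Polynomial → Set
Unimodal f = ∃[ m ] (m ≤ degree
  × (∀ i → i < m → coeff i ≤ coeff (suc i))
  × (∀ i → m ≤ i → i < degree → coeff (suc i) ≤ coeff i))
  where open Polynomial f

-- The vertex set is a decidable subset of an ambient Fin size, so that
-- a graph whose vertices are only some elements of a finite structure
-- needs no relabelling.
record Graph : Set₁ where
  field
    size       : ℕ
    Vertex     : Pred (Fin size) 0ℓ
    Vertex?    : Decidable Vertex
    Adj        : Rel (Fin size) 0ℓ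
    Adj?       : B.Decidable Adj
    Adj-vertex : ∀ {a b} → Adj a b → Vertex a × Vertex b
    Adj-sym    : ∀ {a b} → Adj a b → Adj b a
    Adj-irrefl : ∀ {a} → ¬ Adj a a

allSubsets : ∀ n → List (Subset n)
allSubsets zero    = [] ∷ []
allSubsets (suc n) =
  map (outside ∷_) (allSubsets n) ++ map (inside ∷_) (allSubsets n)

∈-allSubsets : ∀ {n} (S : Subset n) → S ∈ allSubsets n
∈-allSubsets []          = here refl
∈-allSubsets (false ∷ S) = ∈-++⁺ˡ (∈-map⁺ (outside ∷_) (∈-allSubsets S))
∈-allSubsets (true ∷ S)  =
  ∈-++⁺ʳ (map (outside ∷_) (allSubsets _)) (∈-map⁺ (inside ∷_) (∈-allSubsets S))

module _ (G : Graph) where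
  open Graph G

  Independent : Pred (Subset size) 0ℓ
  Independent S = Lift Vertex S × Lift (λ a → Lift (λ b → ¬ Adj a b) S) S

  independent? : Decidable Independent
  independent? S =
    Lift? Vertex? S ×-dec Lift? (λ a → Lift? (λ b → ¬? (Adj? a b)) S) S

  ∅-independent : Independent ⊥
  ∅-independent =
    (λ x∈⊥ → contradiction x∈⊥ ∉⊥) , (λ x∈⊥ → contradiction x∈⊥ ∉⊥)

  independentSets : List (Subset size)
  independentSets = filter independent? (allSubsets size)

  -- allSubsets lists every subset exactly once, so this is a count of
  -- independent sets of size k.
  s : ℕ → ℕ
  s k = length (filter (λ S → ∣ S ∣ ℕ.≟ k) independentSets)

  -- ⊥ here is the empty set, which is itself independent, so using it
  -- as the default does not affect the maximum.
  maximumIndependentSet : Subset size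
  maximumIndependentSet = argmax ∣_∣ ⊥ independentSets

  α : ℕ
  α = ∣ maximumIndependentSet ∣

  s[α]≢0 : s α ≢ 0
  s[α]≢0 = ℕ.m<n⇒n≢0 (∈-length (∈-filter⁺ (λ S → ∣ S ∣ ℕ.≟ α) M∈ refl))
    where
    M∈ : maximumIndependentSet ∈ independentSets
    M∈ = ∈-filter⁺ independent? (∈-allSubsets maximumIndependentSet)
      (argmax-all ∣_∣ {P = Independent} ∅-independent
        (all-filter independent? (allSubsets size)))

  s[>α]≡0 : ∀ k → α < k → s k ≡ 0
  s[>α]≡0 k α<k = cong length (filter-none (λ S → ∣ S ∣ ℕ.≟ k)
    (All.map (λ ∣S∣≤α ∣S∣≡k → ℕ.<⇒≱ α<k (subst (_≤ α) ∣S∣≡k ∣S∣≤α))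
      (f[xs]≤f[argmax] {f = ∣_∣} ⊥ independentSets)))

  independencePolynomial : Polynomial
  independencePolynomial = record
    { degree  = α
    ; coeff   = s
    ; leading = s[α]≢0
    ; above   = s[>α]≡0
    }

-- The elements of ℤₙ are the residues Fin n.
module _ (n : ℕ) .{{_ : NonZero n}} where

  0ₙ : Fin n
  0ₙ = 0 mod n

  infixl 7 _*ₙ_
  _*ₙ_ : Fin n → Fin n → Fin n
  a *ₙ b = (toℕ a * toℕ b) mod n

  NonZeroZeroDivisor : Pred (Fin n) 0ℓ
  NonZeroZeroDivisor a = a ≢ 0ₙ × ∃[ b ] (b ≢ 0ₙ × a *ₙ b ≡ 0ₙ)

  nonZeroZeroDivisor? : Decidable NonZeroZeroDivisor
  nonZeroZeroDivisor? a = ¬? (a Fin.≟ 0ₙ)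
    ×-dec Fin.any? (λ b → ¬? (b Fin.≟ 0ₙ) ×-dec (a *ₙ b Fin.≟ 0ₙ))

  ZeroDivisorAdj : Rel (Fin n) 0ℓ
  ZeroDivisorAdj a b =
    (NonZeroZeroDivisor a × NonZeroZeroDivisor b) × a ≢ b × a *ₙ b ≡ 0ₙ

  *ₙ-comm : ∀ a b → a *ₙ b ≡ b *ₙ a
  *ₙ-comm a b = cong (_mod n) (ℕ.*-comm (toℕ a) (toℕ b))

  zeroDivisorGraph : Graph
  zeroDivisorGraph = record
    { size       = n
    ; Vertex     = NonZeroZeroDivisor
    ; Vertex?    = nonZeroZeroDivisor?
    ; Adj        = ZeroDivisorAdj
    ; Adj?       = λ a b →
        (nonZeroZeroDivisor? a ×-dec nonZeroZeroDivisor? b)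
        ×-dec ¬? (a Fin.≟ b) ×-dec (a *ₙ b Fin.≟ 0ₙ)
    ; Adj-vertex = λ (ab , _) → ab
    ; Adj-sym    = λ {a} {b} ((va , vb) , a≢b , ab≡0) →
        (vb , va) , a≢b ∘ sym , subst (_≡ 0ₙ) (*ₙ-comm a b) ab≡0
    ; Adj-irrefl = λ (_ , a≢a , _) → a≢a refl
    }

{-# OPTIONS --safe #-}
-- Γ(ℤ_pq) is complete bipartite, its parts A and B being the nonzero
-- multiples of p and of q, so s₀ = 1 and s_k = C(|A|,k) + C(|B|,k) for
-- k ≥ 1; the sizes of the parts do not matter. For a ≤ b the polynomial
-- (1 + x)ᵃ + (1 + x)ᵇ = (1 + x)ᵃ (1 + (1 + x)ᵇ⁻ᵃ) is log-concave because
-- its second factor is and multiplication by 1 + x preserves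
-- c_i c_{j+1} ≤ c_{i+1} c_j (i ≤ j). Lowering the constant coefficient
-- from 2 to 1 preserves this too. Unimodality follows by cutting the
-- sequence at its first descent.
module Submission where

open import Defs
open import Data.Fin.Base using (Fin; toℕ)
import Data.Fin.Properties as Fin
open import Data.Fin.Subset using (Subset; ∣_∣; inside; outside; _∈_; _⊆_; Nonempty; _-_)
open import Data.Fin.Subset.Properties
  using (_⊆?_; _∈?_; out⊆; s⊆s; drop-∷-⊆; nonempty?; Empty-unique; ∣⊥∣≡0; x∈p⇒∣p-x∣<∣p∣)
open import Data.List.Base using ([]; _∷_; _++_; map; filter; length)
open import Data.List.Properties using (filter-++; length-++; filter-≐; filter-none)
open import Data.List.Relation.Unary.All as All using ()
open import Data.Bool.Base using (true; false)
open import Data.Nat.Base hiding (∣_-_∣)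
open import Data.Nat.Combinatorics
  using (_C_; nCk+nC[k+1]≡[n+1]C[k+1]; nC1≡n; k>n⇒nCk≡0)
open import Data.Nat.Coprimality using (Coprime; coprime-divisor; prime⇒coprime)
  renaming (sym to coprime-sym)
open import Data.Nat.Divisibility
open import Data.Nat.DivMod using (_mod_; m%n<n; m<n⇒m%n≡m)
open import Data.Nat.Primality using (Prime; prime⇒nonZero; euclidsLemma)
open import Data.Nat.Properties
open import Data.Nat.Solver using (module +-*-Solver)
open import Data.Product.Base using (_×_; _,_; proj₁; proj₂; ∃-syntax)
open import Data.Sum.Base as Sum using (_⊎_; inj₁; inj₂)
open import Data.Vec.Base using ([]; _∷_; here; tabulate)
open import Data.Vec.Properties using (lookup⇒[]=; []=⇒lookup; lookup∘tabulate)
open import Function.Base using (_∘_; case_of_)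
open import Level using (0ℓ)
open import Relation.Binary.PropositionalEquality
open import Relation.Nullary using (¬_; yes; no; does; contradiction)
open import Relation.Nullary.Decidable using (_×-dec_; dec-true)
open import Relation.Unary using (Pred; Decidable)

-- Log-concave sequences and sums of binomial rows

-- The ratios of consecutive terms do not increase, stated without division. Ranging over all
-- `i ≤ j` excludes sequences such as 1, 0, 0, 1, which satisfy only the neighbouring inequalities.
StronglyLogConcave : (ℕ → ℕ) → Set
StronglyLogConcave c = ∀ {i j} → i ≤ j → c i * c (suc j) ≤ c (suc i) * c j

module _ (c c′ : ℕ → ℕ)
         (c′-zero : c′ 0 ≡ c 0) (c′-suc : ∀ k → c′ (suc k) ≡ c k + c (suc k)) where

  -- Both sides expand into four products. One is common to both sides, two are compared directly by
  -- the hypothesis, and the product with the widest index gap is handled by `outer`. At `i = 0` the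
  -- preceding coefficient is missing, hence the separate clauses.
  multiply-by-1+x : StronglyLogConcave c → StronglyLogConcave c′
  multiply-by-1+x slc {zero} {zero} _ = ≤-reflexive (*-comm (c′ 0) (c′ 1))
  multiply-by-1+x slc {zero} {suc j} _
    rewrite c′-zero | c′-suc 0 | c′-suc j | c′-suc (suc j) = begin
    c 0 * (c (suc j) + c (suc (suc j)))
      ≡⟨ *-distribˡ-+ (c 0) _ _ ⟩
    c 0 * c (suc j) + c 0 * c (suc (suc j))
      ≤⟨ +-monoʳ-≤ (c 0 * c (suc j)) (slc z≤n) ⟩
    c 0 * c (suc j) + c 1 * c (suc j)
      ≡⟨ *-distribʳ-+ (c (suc j)) (c 0) (c 1) ⟨
    (c 0 + c 1) * c (suc j)
      ≤⟨ *-monoʳ-≤ (c 0 + c 1) (m≤n+m (c (suc j)) (c j)) ⟩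
    (c 0 + c 1) * (c j + c (suc j)) ∎
    where open ≤-Reasoning
  multiply-by-1+x slc {suc i} {suc j} (s≤s i≤j)
    rewrite c′-suc i | c′-suc (suc i) | c′-suc j | c′-suc (suc j) = begin
    (c i + c (suc i)) * (c (suc j) + c (suc (suc j)))
      ≡⟨ solve 4 (λ a b d e → (a :+ b) :* (d :+ e)
           := a :* d :+ a :* e :+ b :* d :+ b :* e) refl
           (c i) (c (suc i)) (c (suc j)) (c (suc (suc j))) ⟩
    c i * c (suc j) + c i * c (suc (suc j))
      + c (suc i) * c (suc j) + c (suc i) * c (suc (suc j))
      ≤⟨ +-mono-≤ (+-monoˡ-≤ (c (suc i) * c (suc j))
           (+-mono-≤ (slc i≤j) outer)) (slc (s≤s i≤j)) ⟩
    c (suc i) * c j + c (suc (suc i)) * c j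
      + c (suc i) * c (suc j) + c (suc (suc i)) * c (suc j)
      ≡⟨ solve 4 (λ b f g d → b :* g :+ f :* g :+ b :* d :+ f :* d
           := (b :+ f) :* (g :+ d)) refl
           (c (suc i)) (c (suc (suc i))) (c j) (c (suc j)) ⟩
    (c (suc i) + c (suc (suc i))) * (c j + c (suc j)) ∎
    where
    open ≤-Reasoning
    open +-*-Solver
    outer : c i * c (suc (suc j)) ≤ c (suc (suc i)) * c j
    outer with m≤n⇒m<n∨m≡n i≤j
    -- The gap closes in two steps through `c (suc i) * c (suc j)`. The second step needs
    -- `suc i ≤ j`; when `i = j` the two sides already agree.
    ... | inj₁ i<j  = ≤-trans (slc (m≤n⇒m≤1+n i≤j)) (slc i<j)
    ... | inj₂ refl = ≤-reflexive (*-comm (c i) (c (suc (suc i))))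

C-stronglyLogConcave : ∀ n → StronglyLogConcave (n C_)
C-stronglyLogConcave zero {i} {j} _
  rewrite k>n⇒nCk≡0 {0} {suc j} z<s | *-zeroʳ (0 C i) = z≤n
C-stronglyLogConcave (suc n) = multiply-by-1+x (n C_) (suc n C_)
  refl
  (λ k → sym (nCk+nC[k+1]≡[n+1]C[k+1] n k))
  (C-stronglyLogConcave n)

2*nC2≤n*n : ∀ n → 2 * (n C 2) ≤ n * n
2*nC2≤n*n zero    = z≤n
2*nC2≤n*n (suc n) = begin
  2 * (suc n C 2)           ≡⟨ cong (2 *_) (nCk+nC[k+1]≡[n+1]C[k+1] n 1) ⟨
  2 * (n C 1 + n C 2)       ≡⟨ cong (λ m → 2 * (m + n C 2)) (nC1≡n n) ⟩
  2 * (n + n C 2)           ≡⟨ *-distribˡ-+ 2 n (n C 2) ⟩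
  2 * n + 2 * (n C 2)       ≤⟨ +-monoʳ-≤ (2 * n) (2*nC2≤n*n n) ⟩
  2 * n + n * n             ≤⟨ n≤1+n _ ⟩
  suc (2 * n + n * n)       ≡⟨ solve 1 (λ n → con 1 :+ (con 2 :* n :+ n :* n)
                                 := (con 1 :+ n) :* (con 1 :+ n)) refl n ⟩
  suc n * suc n             ∎
  where
  open ≤-Reasoning
  open +-*-Solver

-- This is the inequality between indices 0 and `k` for 1 + (1 + x)ⁿ, whose first two coefficients
-- are 2 and `n`. After multiplication by `n = n C 1`, it follows from the log-concavity of the row
-- and 2 C(n,2) ≤ n².
2*nC[k+1]≤n*nCk : ∀ n k → 1 ≤ k → 2 * (n C suc k) ≤ n * (n C k)
2*nC[k+1]≤n*nCk zero      k 1≤k rewrite k>n⇒nCk≡0 {0} {suc k} z<s = z≤n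
2*nC[k+1]≤n*nCk n@(suc _) k 1≤k = *-cancelˡ-≤ n (begin
  n * (2 * (n C suc k))       ≡⟨ solve 2 (λ n a → n :* (con 2 :* a) := con 2 :* (n :* a))
                                   refl n (n C suc k) ⟩
  2 * (n * (n C suc k))       ≡⟨ cong (λ m → 2 * (m * (n C suc k))) (nC1≡n n) ⟨
  2 * ((n C 1) * (n C suc k)) ≤⟨ *-monoʳ-≤ 2 (C-stronglyLogConcave n 1≤k) ⟩
  2 * ((n C 2) * (n C k))     ≡⟨ *-assoc 2 (n C 2) (n C k) ⟨
  2 * (n C 2) * (n C k)       ≤⟨ *-monoˡ-≤ (n C k) (2*nC2≤n*n n) ⟩
  n * n * (n C k)             ≡⟨ *-assoc n n (n C k) ⟩
  n * (n * (n C k))           ∎)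
  where
  open ≤-Reasoning
  open +-*-Solver

-- Common factors 1 + x are stripped until one exponent is 0. What remains, 1 + (1 + x)ᵇ, differs
-- from a binomial row only at index 0.
C+C-stronglyLogConcave : ∀ a b → StronglyLogConcave (λ k → a C k + b C k)
C+C-stronglyLogConcave zero b {zero} {zero} _ =
  ≤-reflexive (*-comm (0 C 0 + b C 0) (0 C 1 + b C 1))
C+C-stronglyLogConcave zero b {zero} {j@(suc _)} _
  rewrite k>n⇒nCk≡0 {0} {j} z<s | k>n⇒nCk≡0 {0} {suc j} z<s
        | nC1≡n b = 2*nC[k+1]≤n*nCk b j (s≤s z≤n)
C+C-stronglyLogConcave zero b {i@(suc _)} {j@(suc _)} i≤j
  rewrite k>n⇒nCk≡0 {0} {j} z<s | k>n⇒nCk≡0 {0} {suc j} z<s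
        | k>n⇒nCk≡0 {0} {i} z<s | k>n⇒nCk≡0 {0} {suc i} z<s
        = C-stronglyLogConcave b i≤j
C+C-stronglyLogConcave a@(suc _) zero {i} {j} i≤j
  rewrite +-comm (a C i) (0 C i) | +-comm (a C suc i) (0 C suc i)
        | +-comm (a C j) (0 C j) | +-comm (a C suc j) (0 C suc j)
        = C+C-stronglyLogConcave zero a i≤j
C+C-stronglyLogConcave (suc a) (suc b) = multiply-by-1+x
  (λ k → a C k + b C k) (λ k → suc a C k + suc b C k)
  refl
  pascal
  (C+C-stronglyLogConcave a b)
  where
  open +-*-Solver
  pascal : ∀ k → suc a C suc k + suc b C suc k
               ≡ (a C k + b C k) + (a C suc k + b C suc k)
  pascal k = trans
    (sym (cong₂ _+_ (nCk+nC[k+1]≡[n+1]C[k+1] a k) (nCk+nC[k+1]≡[n+1]C[k+1] b k)))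
    (solve 4 (λ u v w x → (u :+ v) :+ (w :+ x) := (u :+ w) :+ (v :+ x)) refl
      (a C k) (a C suc k) (b C k) (b C suc k))

-- The head occurs on the larger side only when `i = j = 0`, where both sides are equal. Elsewhere
-- lowering it can only shrink the smaller side.
decrease-head : (c c′ : ℕ → ℕ) → c′ 0 ≤ c 0 → (∀ k → c′ (suc k) ≡ c (suc k)) →
                StronglyLogConcave c → StronglyLogConcave c′
decrease-head c c′ _ _ _ {zero} {zero} _ = ≤-reflexive (*-comm (c′ 0) (c′ 1))
decrease-head c c′ head tail slc {zero} {suc j} i≤j
  rewrite tail 0 | tail j | tail (suc j) =
  ≤-trans (*-monoˡ-≤ (c (suc (suc j))) head) (slc i≤j)
decrease-head c c′ head tail slc {suc i} {suc j} i≤j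
  rewrite tail i | tail (suc i) | tail j | tail (suc j) = slc i≤j

-- From strong log-concavity to log-concavity and unimodality

module _ (f : Polynomial) (slc : StronglyLogConcave (Polynomial.coeff f)) where
  open Polynomial f

  stronglyLogConcave⇒logConcave : LogConcave f
  stronglyLogConcave⇒logConcave j@(suc i) _ _ = begin
    coeff i * coeff (j + 1)  ≡⟨ cong (λ m → coeff i * coeff m) (+-comm j 1) ⟩
    coeff i * coeff (suc j)  ≤⟨ slc (n≤1+n i) ⟩
    coeff j * coeff j        ≡⟨ cong (coeff j *_) (*-identityʳ (coeff j)) ⟨
    coeff j ^ 2              ∎
    where open ≤-Reasoning

  -- The known descent at `n` bounds the search. The ascents are kept strict because strictness
  -- later makes the peak coefficient positive.
  firstDescent : ∀ n → coeff (suc n) ≤ coeff n →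
    ∃[ m ] (m ≤ n × (∀ i → i < m → coeff i < coeff (suc i)) × coeff (suc m) ≤ coeff m)
  firstDescent n descent = search n 0 (+-identityʳ n) (λ _ ())
    where
    -- `k` is the position under test and `d` the distance left to the known descent, on which the
    -- recursion runs.
    search : ∀ d k → d + k ≡ n → (∀ i → i < k → coeff i < coeff (suc i)) →
      ∃[ m ] (m ≤ n × (∀ i → i < m → coeff i < coeff (suc i)) × coeff (suc m) ≤ coeff m)
    search zero    k refl asc = k , ≤-refl , asc , descent
    search (suc d) k d+k≡n asc with coeff (suc k) ≤? coeff k
    ... | yes desc = k , subst (k ≤_) d+k≡n (m≤n+m k (suc d)) , asc , desc
    ... | no ¬desc = search d (suc k) (trans (+-suc d k) d+k≡n) asc′
      where
      asc′ : ∀ i → i < suc k → coeff i < coeff (suc i)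
      asc′ i (s≤s i≤k) with m≤n⇒m<n∨m≡n i≤k
      ... | inj₁ i<k  = asc i i<k
      ... | inj₂ refl = ≰⇒> ¬desc

  stronglyLogConcave⇒unimodal : 0 < coeff 0 → Unimodal f
  stronglyLogConcave⇒unimodal 0<coeff0
    -- The coefficient just beyond the degree is 0, so a descent occurs at the degree at the latest.
    with firstDescent degree (subst (_≤ coeff degree) (sym (above (suc degree) ≤-refl)) z≤n)
  ... | m , m≤deg , asc , desc =
    m , m≤deg , (λ i i<m → <⇒≤ (asc i i<m)) , λ i m≤i _ → descending i m≤i
    where
    open ≤-Reasoning
    0<coeff-m : ∀ k → (∀ i → i < k → coeff i < coeff (suc i)) → 0 < coeff k
    0<coeff-m zero    _   = 0<coeff0
    0<coeff-m (suc k) asc = m<n⇒0<n (asc k ≤-refl)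

    descending : ∀ i → m ≤ i → coeff (suc i) ≤ coeff i
    -- The descent at `m` is carried to every later `i` by comparing ratios; the positive factor
    -- `coeff m` is then cancelled.
    descending i m≤i = *-cancelˡ-≤ (coeff m) {{>-nonZero (0<coeff-m m asc)}} (begin
      coeff m * coeff (suc i)  ≤⟨ slc m≤i ⟩
      coeff (suc m) * coeff i  ≤⟨ *-monoˡ-≤ (coeff i) desc ⟩
      coeff m * coeff i        ∎)

-- Counting subsets of a given size

module _ {A : Set} where

  filter-filter : ∀ {P Q : Pred A 0ℓ} (P? : Decidable P) (Q? : Decidable Q) xs →
    filter P? (filter Q? xs) ≡ filter (λ x → Q? x ×-dec P? x) xs
  filter-filter P? Q? []       = refl
  filter-filter P? Q? (x ∷ xs) with ih ← filter-filter P? Q? xs | does (Q? x)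
  ... | false = ih
  ... | true with does (P? x)
  ...   | false = ih
  ...   | true  = cong (x ∷_) ih

  length-filter-map : ∀ {B : Set} {P : Pred A 0ℓ} (P? : Decidable P) (f : B → A) xs →
    length (filter P? (map f xs)) ≡ length (filter (P? ∘ f) xs)
  length-filter-map P? f []       = refl
  length-filter-map P? f (x ∷ xs) with ih ← length-filter-map P? f xs | does (P? (f x))
  ... | false = ih
  ... | true  = cong suc ih

  length-filter-⊎ : ∀ {P Q R : Pred A 0ℓ}
    (P? : Decidable P) (Q? : Decidable Q) (R? : Decidable R) →
    (∀ {x} → P x → Q x ⊎ R x) → (∀ {x} → Q x → P x) → (∀ {x} → R x → P x) →
    (∀ {x} → Q x → ¬ R x) → ∀ xs →
    length (filter P? xs) ≡ length (filter Q? xs) + length (filter R? xs)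
  length-filter-⊎ P? Q? R? split Q⇒P R⇒P disjoint []       = refl
  length-filter-⊎ P? Q? R? split Q⇒P R⇒P disjoint (x ∷ xs)
    with ih ← length-filter-⊎ P? Q? R? split Q⇒P R⇒P disjoint xs
    | P? x | Q? x | R? x
  ... | yes p | yes q | yes r = contradiction r (disjoint q)
  ... | yes p | yes q | no ¬r = cong suc ih
  ... | yes p | no ¬q | yes r = trans (cong suc ih) (sym (+-suc _ _))
  ... | yes p | no ¬q | no ¬r = contradiction (split p) Sum.[ ¬q , ¬r ]
  ... | no ¬p | yes q | _     = contradiction (Q⇒P q) ¬p
  ... | no ¬p | no ¬q | yes r = contradiction (R⇒P r) ¬p
  ... | no ¬p | no ¬q | no ¬r = ih

IsKSubset : ∀ {n} → Subset n → ℕ → Pred (Subset n) 0ℓ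
IsKSubset A k S = S ⊆ A × ∣ S ∣ ≡ k

isKSubset? : ∀ {n} (A : Subset n) k → Decidable (IsKSubset A k)
isKSubset? A k S = (S ⊆? A) ×-dec (∣ S ∣ ≟ k)

-- Pascal's rule: the subsets are split by whether they contain the first element of the ambient
-- set.
count-KSubsets : ∀ {n} (A : Subset n) k →
  length (filter (isKSubset? A k) (allSubsets n)) ≡ ∣ A ∣ C k
count-KSubsets []          zero    = refl
count-KSubsets []          (suc k) = sym (k>n⇒nCk≡0 {0} {suc k} z<s)
count-KSubsets {suc n} (x ∷ A) k = begin
  length (filter P? (map (outside ∷_) subs ++ map (inside ∷_) subs))
    ≡⟨ cong length (filter-++ P? (map (outside ∷_) subs) _) ⟩
  length (filter P? (map (outside ∷_) subs) ++ filter P? (map (inside ∷_) subs))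
    ≡⟨ length-++ (filter P? (map (outside ∷_) subs)) ⟩
  length (filter P? (map (outside ∷_) subs)) + length (filter P? (map (inside ∷_) subs))
    ≡⟨ cong₂ _+_ (length-filter-map P? (outside ∷_) subs)
                 (length-filter-map P? (inside ∷_) subs) ⟩
  length (filter (P? ∘ (outside ∷_)) subs) + length (filter (P? ∘ (inside ∷_)) subs)
    ≡⟨ cong (_+ length (filter (P? ∘ (inside ∷_)) subs)) (trans
         (cong length (filter-≐ (P? ∘ (outside ∷_)) (isKSubset? A k)
           ( (λ (S⊆A , ∣S∣≡k) → drop-∷-⊆ S⊆A , ∣S∣≡k)
           , (λ (S⊆A , ∣S∣≡k) → out⊆ S⊆A , ∣S∣≡k)) subs))
         (count-KSubsets A k)) ⟩
  ∣ A ∣ C k + length (filter (P? ∘ (inside ∷_)) subs)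
    ≡⟨ with-first x k ⟩
  ∣ x ∷ A ∣ C k ∎
  where
  open ≡-Reasoning
  subs = allSubsets n
  P? = isKSubset? (x ∷ A) k

  with-first : ∀ x k → ∣ A ∣ C k +
    length (filter (isKSubset? (x ∷ A) k ∘ (inside ∷_)) subs) ≡ ∣ x ∷ A ∣ C k
  -- A subset containing the first element cannot lie in a set that lacks it.
  with-first outside k = trans
    (cong (λ l → ∣ A ∣ C k + length l)
      (filter-none (isKSubset? (outside ∷ A) k ∘ (inside ∷_))
        (All.universal (λ S (S⊆A , _) → case S⊆A here of λ ()) subs)))
    (+-identityʳ (∣ A ∣ C k))
  with-first inside zero = cong (λ l → 1 + length l)
    (filter-none (isKSubset? (inside ∷ A) 0 ∘ (inside ∷_))
      (All.universal (λ { S (_ , ()) }) subs))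
  with-first inside (suc k) = begin
    ∣ A ∣ C suc k + length (filter (isKSubset? (inside ∷ A) (suc k) ∘ (inside ∷_)) subs)
      ≡⟨ cong (λ l → ∣ A ∣ C suc k + length l)
           (filter-≐ (isKSubset? (inside ∷ A) (suc k) ∘ (inside ∷_)) (isKSubset? A k)
             ( (λ (S⊆A , ∣S∣≡k) → drop-∷-⊆ S⊆A , suc-injective ∣S∣≡k)
             , (λ (S⊆A , ∣S∣≡k) → s⊆s S⊆A , cong suc ∣S∣≡k)) subs) ⟩
    ∣ A ∣ C suc k + length (filter (isKSubset? A k) subs)
      ≡⟨ cong (∣ A ∣ C suc k +_) (count-KSubsets A k) ⟩
    ∣ A ∣ C suc k + ∣ A ∣ C k
      ≡⟨ +-comm (∣ A ∣ C suc k) _ ⟩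
    ∣ A ∣ C k + ∣ A ∣ C suc k
      ≡⟨ nCk+nC[k+1]≡[n+1]C[k+1] ∣ A ∣ k ⟩
    suc ∣ A ∣ C suc k ∎

-- Deleting a member would bring the size below 0.
∣S∣≡0⇒∉ : ∀ {n} {S : Subset n} {x} → ∣ S ∣ ≡ 0 → ¬ (x ∈ S)
∣S∣≡0⇒∉ {S = S} {x} ∣S∣≡0 x∈S =
  n≮0 (subst (∣ S - x ∣ <_) ∣S∣≡0 (x∈p⇒∣p-x∣<∣p∣ x∈S))

∣S∣≡1+k⇒nonempty : ∀ {n} {S : Subset n} {k} → ∣ S ∣ ≡ suc k → Nonempty S
∣S∣≡1+k⇒nonempty {n} {S} ∣S∣≡1+k with nonempty? S
... | yes x∈S  = x∈S
... | no empty =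
  contradiction (trans (sym ∣S∣≡1+k) (trans (cong ∣_∣ (Empty-unique empty)) (∣⊥∣≡0 n))) λ ()

module _ {n} {P : Pred (Fin n) 0ℓ} (P? : Decidable P) where

  comprehension : Subset n
  comprehension = tabulate (does ∘ P?)

  ∈-comprehension⁺ : ∀ {x} → P x → x ∈ comprehension
  ∈-comprehension⁺ {x} px =
    lookup⇒[]= x comprehension (trans (lookup∘tabulate (does ∘ P?) x) (dec-true (P? x) px))

  ∈-comprehension⁻ : ∀ {x} → x ∈ comprehension → P x
  ∈-comprehension⁻ {x} x∈
    with P? x | trans (sym (lookup∘tabulate (does ∘ P?) x)) ([]=⇒lookup x∈)
  ... | yes px | _ = px

-- Independent sets of a complete bipartite graph

-- Disjointness of the parts follows from `complete` and `Adj-irrefl`.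
record CompleteBipartition (G : Graph) : Set where
  open Graph G
  field
    A B           : Subset size
    A-independent : Independent G A
    B-independent : Independent G B
    cover         : ∀ {x} → Vertex x → x ∈ A ⊎ x ∈ B
    complete      : ∀ {a b} → a ∈ A → b ∈ B → Adj a b

module _ {G : Graph} (bipartition : CompleteBipartition G) where
  open Graph G
  open CompleteBipartition bipartition

  ⊆-independent : ∀ {S T} → S ⊆ T → Independent G T → Independent G S
  ⊆-independent S⊆T (vertices , nonadjacent) =
    (λ x∈S → vertices (S⊆T x∈S)) , λ a∈S b∈S → nonadjacent (S⊆T a∈S) (S⊆T b∈S)

  -- A member in `B` is adjacent to everything in `A`, so its presence forces the whole set into
  -- `B`. Deciding whether `S` meets `B` therefore selects the part.
  independent⇒⊆ : ∀ {S} → Independent G S → S ⊆ A ⊎ S ⊆ B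
  independent⇒⊆ {S} (vertices , nonadjacent)
    with Fin.any? (λ b → (b ∈? S) ×-dec (b ∈? B))
  ... | yes (b , b∈S , b∈B) = inj₂ λ x∈S → case cover (vertices x∈S) of λ where
    (inj₁ x∈A) → contradiction (complete x∈A b∈B) (nonadjacent x∈S b∈S)
    (inj₂ x∈B) → x∈B
  ... | no ¬∃b = inj₁ λ {x} x∈S → case cover (vertices x∈S) of λ where
    (inj₁ x∈A) → x∈A
    (inj₂ x∈B) → contradiction (x , x∈S , x∈B) ¬∃b

  independentKSet? : ∀ k → Decidable (λ S → Independent G S × ∣ S ∣ ≡ k)
  independentKSet? k S = independent? G S ×-dec (∣ S ∣ ≟ k)

  s≡count : ∀ k → s G k ≡ length (filter (independentKSet? k) (allSubsets size))
  s≡count k = cong length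
    (filter-filter (λ S → ∣ S ∣ ≟ k) (independent? G) (allSubsets size))

  -- The empty set lies in both parts and must be counted once, so it is counted through `A` alone.
  s-zero : s G 0 ≡ 1
  s-zero = trans (s≡count 0) (trans
    (cong length (filter-≐ (independentKSet? 0) (isKSubset? A 0)
      ( (λ (_ , ∣S∣≡0) → (λ x∈S → contradiction x∈S (∣S∣≡0⇒∉ ∣S∣≡0)) , ∣S∣≡0)
      , (λ (S⊆A , ∣S∣≡0) → ⊆-independent S⊆A A-independent , ∣S∣≡0))
      (allSubsets size)))
    (count-KSubsets A 0))

  s-suc : ∀ k → s G (suc k) ≡ ∣ A ∣ C suc k + ∣ B ∣ C suc k
  s-suc k = trans (s≡count (suc k)) (trans
    (length-filter-⊎ (independentKSet? (suc k)) (isKSubset? A (suc k)) (isKSubset? B (suc k))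
      split
      (λ (S⊆A , ∣S∣≡) → ⊆-independent S⊆A A-independent , ∣S∣≡)
      (λ (S⊆B , ∣S∣≡) → ⊆-independent S⊆B B-independent , ∣S∣≡)
      -- A nonempty set inside both parts would have a member adjacent to itself.
      (λ (S⊆A , ∣S∣≡) (S⊆B , _) → let x , x∈S = ∣S∣≡1+k⇒nonempty ∣S∣≡ in
        Adj-irrefl (complete (S⊆A x∈S) (S⊆B x∈S)))
      (allSubsets size))
    (cong₂ _+_ (count-KSubsets A (suc k)) (count-KSubsets B (suc k))))
    where
    split : ∀ {S} → Independent G S × ∣ S ∣ ≡ suc k →
            IsKSubset A (suc k) S ⊎ IsKSubset B (suc k) S
    split {S} (independent , ∣S∣≡) with independent⇒⊆ {S} independent
    ... | inj₁ S⊆A = inj₁ (S⊆A , ∣S∣≡)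
    ... | inj₂ S⊆B = inj₂ (S⊆B , ∣S∣≡)

  independencePolynomial-stronglyLogConcave : StronglyLogConcave (s G)
  independencePolynomial-stronglyLogConcave =
    decrease-head (λ k → ∣ A ∣ C k + ∣ B ∣ C k) (s G)
      -- The binomial sum has constant coefficient 2, since each part counts the empty set.
      (≤-trans (≤-reflexive s-zero) (n≤1+n 1)) s-suc
      (C+C-stronglyLogConcave ∣ A ∣ ∣ B ∣)

-- Zero residues and divisibility

module _ {n : ℕ} .{{_ : NonZero n}} where

  toℕ-0ₙ : toℕ (0ₙ n) ≡ 0
  toℕ-0ₙ = trans (Fin.toℕ-fromℕ< (m%n<n 0 n)) (n∣m⇒m%n≡0 0 n (n ∣0))

  mod≡0ₙ⇒∣ : ∀ {m} → m mod n ≡ 0ₙ n → n ∣ m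
  mod≡0ₙ⇒∣ {m} eq = m%n≡0⇒n∣m m n
    (trans (sym (Fin.toℕ-fromℕ< (m%n<n m n))) (trans (cong toℕ eq) toℕ-0ₙ))

  ∣⇒mod≡0ₙ : ∀ {m} → n ∣ m → m mod n ≡ 0ₙ n
  ∣⇒mod≡0ₙ {m} n∣m = Fin.toℕ-injective
    (trans (Fin.toℕ-fromℕ< (m%n<n m n)) (trans (n∣m⇒m%n≡0 m n n∣m) (sym toℕ-0ₙ)))

  ∣toℕ⇒≡0ₙ : ∀ {a : Fin n} → n ∣ toℕ a → a ≡ 0ₙ n
  ∣toℕ⇒≡0ₙ {a} n∣a = Fin.toℕ-injective (trans toℕ-a≡0 (sym toℕ-0ₙ))
    where
    toℕ-a≡0 : toℕ a ≡ 0
    toℕ-a≡0 = trans (sym (m<n⇒m%n≡m (Fin.toℕ<n a))) (n∣m⇒m%n≡0 (toℕ a) n n∣a)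

-- With `o = k * n`, coprimality forces `m` to divide `k`.
coprime⇒*∣ : ∀ {m n o} → Coprime m n → m ∣ o → n ∣ o → m * n ∣ o
coprime⇒*∣ {m} {n} coprime m∣o (divides-refl k) =
  *-monoˡ-∣ n (coprime-divisor coprime (subst (m ∣_) (*-comm k n) m∣o))

-- The bipartition of the zero divisor graph of ℤ_pq

module _ {p q : ℕ} (pp : Prime p) (qp : Prime q) (p<q : p < q) where
  private instance
    p≢0 = prime⇒nonZero pp
    q≢0 = prime⇒nonZero qp
    pq≢0 = m*n≢0 p q

  private
    Γ = zeroDivisorGraph (p * q)
    open Graph Γ using (Vertex; Vertex?; Adj)

    MultipleVertex : ℕ → Pred (Fin (p * q)) 0ℓ
    MultipleVertex r x = Vertex x × r ∣ toℕ x

    multipleVertex? : ∀ r → Decidable (MultipleVertex r)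
    multipleVertex? r x = Vertex? x ×-dec (r ∣? toℕ x)

    -- A positive number below the prime `q` is coprime to `q`; this is how `p < q` enters. Hence
    -- `p * q` divides a representative smaller than itself.
    p∣∧q∣⇒≡0ₙ : ∀ {a} → p ∣ toℕ a → q ∣ toℕ a → a ≡ 0ₙ (p * q)
    p∣∧q∣⇒≡0ₙ p∣a q∣a =
      ∣toℕ⇒≡0ₙ (coprime⇒*∣ (coprime-sym (prime⇒coprime qp p<q)) p∣a q∣a)

    -- Each prime divides `x` or its annihilator `y`. Both cannot divide `y`, which is nonzero.
    vertex⇒p∣⊎q∣ : ∀ {x} → Vertex x → (p ∣ toℕ x) ⊎ (q ∣ toℕ x)
    vertex⇒p∣⊎q∣ {x} (_ , y , y≢0 , xy≡0)
      with pq∣xy ← mod≡0ₙ⇒∣ xy≡0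
      with euclidsLemma (toℕ x) (toℕ y) pp (m*n∣⇒m∣ p q pq∣xy)
         | euclidsLemma (toℕ x) (toℕ y) qp (m*n∣⇒n∣ p q pq∣xy)
    ... | inj₁ p∣x | _        = inj₁ p∣x
    ... | inj₂ _   | inj₁ q∣x = inj₂ q∣x
    ... | inj₂ p∣y | inj₂ q∣y = contradiction (p∣∧q∣⇒≡0ₙ p∣y q∣y) y≢0

    -- A zero product would make `q` divide one of the factors, which would then be zero.
    multiples-of-p-nonadjacent : ∀ {a b} → p ∣ toℕ a → p ∣ toℕ b → ¬ Adj a b
    multiples-of-p-nonadjacent {a} {b} p∣a p∣b (((a≢0 , _) , (b≢0 , _)) , _ , ab≡0)
      with euclidsLemma (toℕ a) (toℕ b) qp (m*n∣⇒n∣ p q (mod≡0ₙ⇒∣ ab≡0))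
    ... | inj₁ q∣a = a≢0 (p∣∧q∣⇒≡0ₙ p∣a q∣a)
    ... | inj₂ q∣b = b≢0 (p∣∧q∣⇒≡0ₙ p∣b q∣b)

    multiples-of-q-nonadjacent : ∀ {a b} → q ∣ toℕ a → q ∣ toℕ b → ¬ Adj a b
    multiples-of-q-nonadjacent {a} {b} q∣a q∣b (((a≢0 , _) , (b≢0 , _)) , _ , ab≡0)
      with euclidsLemma (toℕ a) (toℕ b) pp (m*n∣⇒m∣ p q (mod≡0ₙ⇒∣ ab≡0))
    ... | inj₁ p∣a = a≢0 (p∣∧q∣⇒≡0ₙ p∣a q∣a)
    ... | inj₂ p∣b = b≢0 (p∣∧q∣⇒≡0ₙ p∣b q∣b)

    multiples-adjacent : ∀ {a b} → MultipleVertex p a → MultipleVertex q b → Adj a b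
    multiples-adjacent (va@(a≢0 , _) , p∣a) (vb , q∣b) =
      -- Equal endpoints would be divisible by both primes, hence zero.
      (va , vb) , (λ { refl → a≢0 (p∣∧q∣⇒≡0ₙ p∣a q∣b) }) , ∣⇒mod≡0ₙ (*-pres-∣ p∣a q∣b)

  zeroDivisorGraph-completeBipartition : CompleteBipartition (zeroDivisorGraph (p * q))
  zeroDivisorGraph-completeBipartition = record
    { A = comprehension P?
    ; B = comprehension Q?
    ; A-independent = (proj₁ ∘ ∈-comprehension⁻ P?)
                    , λ a∈A b∈A → multiples-of-p-nonadjacent
                        (proj₂ (∈-comprehension⁻ P? a∈A)) (proj₂ (∈-comprehension⁻ P? b∈A))
    ; B-independent = (proj₁ ∘ ∈-comprehension⁻ Q?)
                    , λ a∈B b∈B → multiples-of-q-nonadjacent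
                        (proj₂ (∈-comprehension⁻ Q? a∈B)) (proj₂ (∈-comprehension⁻ Q? b∈B))
    ; cover = λ vx → Sum.map (λ p∣x → ∈-comprehension⁺ P? (vx , p∣x))
                             (λ q∣x → ∈-comprehension⁺ Q? (vx , q∣x)) (vertex⇒p∣⊎q∣ vx)
    ; complete = λ a∈A b∈B → multiples-adjacent
        (∈-comprehension⁻ P? a∈A) (∈-comprehension⁻ Q? b∈B)
    }
    where
    P? = multipleVertex? p
    Q? = multipleVertex? q

theorem2p5 : (p q : ℕ) (pp : Prime p) (qp : Prime q) → p < q →
    let instance pq≢0 = m*n≢0 p q {{prime⇒nonZero pp}} {{prime⇒nonZero qp}}
        I = independencePolynomial (zeroDivisorGraph (p * q))
    in LogConcave I × Unimodal I
theorem2p5 p q pp qp p<q =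
    stronglyLogConcave⇒logConcave I slc
  -- The empty set gives constant coefficient 1, hence a positive one.
  , stronglyLogConcave⇒unimodal I slc (≤-reflexive (sym (s-zero bipartition)))
  where
  instance pq≢0 = m*n≢0 p q {{prime⇒nonZero pp}} {{prime⇒nonZero qp}}
  I = independencePolynomial (zeroDivisorGraph (p * q))
  bipartition = zeroDivisorGraph-completeBipartition pp qp p<q
  slc = independencePolynomial-stronglyLogConcave bipartition
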